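{- Let $\mathbf{K}$ be a quasivariety and $\langle\delta(x),\epsilon(x)\rangle$ an equation over its signature. Suppose that every inclusion $\sigma:Fm(Z)\hookrightarrow Fm(X)$ of free algebras coming from an inclusion of generators $Z\subseteq X$ induces a conservative extension of equational theories, i.e. that for every congruence $\theta\in Co_{\mathbf{K}}(Fm(X))$ we have $$Cn_{\mathbf{K}}^X\big(\{\langle\delta(\varphi),\epsilon(\varphi)\rangle\in\theta\mid\varphi\in Fm(X)\}\big)\cap Fm(Z)^2=Cn_{\mathbf{K}}^Z\big(\{\langle\delta(\varphi),\epsilon(\varphi)\rangle\in\theta\mid\varphi\in Fm(Z)\}\big).$$ Then the equational filter pair $(Co_{\mathbf{K}},i)$ associated to the equation $\langle\delta(x),\epsilon(x)\rangle$ satisfies: for every inclusion of sets $Z\subseteq X$ with induced inclusion $\sigma:Fm(Z)\hookrightarrow Fm(X)$ and every theory $T\subseteq Fm(X)$, $$(\sigma\times\sigma)^{ -1}(\Xi_{Fm(X)}(T))=\Xi_{Fm(Z)}(\sigma^{ -1}(T)).$$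
   Context: $Fm(X)$ is the absolutely free algebra (over the signature $\Sigma$ of $\mathbf{K}$) on a set $X$ of variables. A quasivariety is a class of algebras axiomatizable by quasi-identities. The equation is in at most one variable $x$. For a set $\Gamma\subseteq Fm(X)\times Fm(X)$, $Cn_{\mathbf{K}}^X(\Gamma)$ is the set of pairs $\langle\varphi,\psi\rangle\in Fm(X)^2$ such that for every $A\in\mathbf{K}$ and every homomorphism $h:Fm(X)\to A$ with $h(\eta)=h(\nu)$ for all $\langle\eta,\nu\rangle\in\Gamma$ one has $h(\varphi)=h(\psi)$ (equivalently, the $\mathbf{K}$-congruence on $Fm(X)$ generated by $\Gamma$). $Co_{\mathbf{K}}(A)$ is the lattice of congruences $\theta$ on $A$ with $A/\theta\in\mathbf{K}$, ordered by inclusion. The equational filter pair $(Co_{\mathbf{K}},i)$ associated to the equation is given by $i_A:Co_{\mathbf{K}}(A)\to\mathcal{P}(A)$, $i_A(\theta)=\{a\in A\mid\langle\delta^A(a),\epsilon^A(a)\rangle\in\theta\}$. $\Xi_A:\mathcal{P}(A)\to Co_{\mathbf{K}}(A)$ is the left adjoint of $i_A$: $\Xi_A(S)\subseteq\theta\iff S\subseteq i_A(\theta)$. A theory in $Fm(X)$ is a set in the image of $i_{Fm(X)}$ (equivalently, a filter on $Fm(X)$ of the associated logic). -}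

module Defs where

open import Level using (Level; _⊔_; suc)
open import Data.List.Base using (List)
open import Data.List.Relation.Unary.All using (All; []; _∷_)
open import Data.Nat.Base using (ℕ)
open import Data.Product.Base using (Σ-syntax; ∃-syntax; _×_; _,_; proj₁; proj₂)
open import Data.Unit.Base using (⊤)
open import Data.Vec.Base using (Vec; []; _∷_; map)
open import Data.Vec.Relation.Binary.Pointwise.Inductive using (Pointwise; []; _∷_; Pointwise-≡⇒≡)
open import Function.Bundles using (_⇔_; Equivalence; Injection; _↣_)
open import Relation.Binary.Bundles using (Setoid)
open import Relation.Binary.Core using (Rel; _⇒_)
open import Relation.Binary.Definitions using (Adjoint)
open import Relation.Binary.PropositionalEquality using (_≡_; refl; cong; cong₂; sym; subst₂) renaming (setoid to ≡-setoid)
open import Relation.Binary.Structures using (IsEquivalence)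
open import Relation.Unary using (Pred; _∈_; _⊆_; _≐_)

-- Throughout, the sets, algebras, subsets and relations of the theory live at
-- one universe level ℓ, so that free algebras and their quotients are among
-- the algebras that a class K may contain.

private
  variable
    ℓ x κ : Level

record Signature (ℓ : Level) : Set (suc ℓ) where
  field
    Op    : Set ℓ
    arity : Op → ℕ

open Signature public

-- Algebras are setoid-based, so that A / θ is the carrier of A with θ as its
-- equality.

record Algebra (S : Signature ℓ) : Set (suc ℓ) where
  field
    setoid : Setoid ℓ ℓ

  open Setoid setoid public using (Carrier; _≈_; isEquivalence)

  field
    op      : (f : Op S) → Vec Carrier (arity S f) → Carrier
    op-cong : ∀ f {as bs} → Pointwise _≈_ as bs → op f as ≈ op f bs

open Algebra public using (Carrier)

data Term (S : Signature ℓ) (X : Set x) : Set (ℓ ⊔ x) where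
  var  : X → Term S X
  node : (f : Op S) → Vec (Term S X) (arity S f) → Term S X

Fm : (S : Signature ℓ) → Set ℓ → Algebra S
Fm S X = record
  { setoid  = ≡-setoid (Term S X)
  ; op      = node
  ; op-cong = λ f ts≡us → cong (node f) (Pointwise-≡⇒≡ ts≡us)
  }

module _ {S : Signature ℓ} (A : Algebra S) {X : Set x} (ρ : X → Carrier A) where

  eval  : Term S X → Carrier A
  evals : ∀ {n} → Vec (Term S X) n → Vec (Carrier A) n

  eval (var v)     = ρ v
  eval (node f ts) = Algebra.op A f (evals ts)

  evals []       = []
  evals (t ∷ ts) = eval t ∷ evals ts

-- The operation δ^A of a term in (at most) one variable; on A = Fm S X it is
-- the substitution φ ↦ δ(φ).

infix 8 _^_

_^_ : {S : Signature ℓ} → Term S ⊤ → (A : Algebra S) → Carrier A → Carrier A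
(δ ^ A) a = eval A (λ _ → a) δ

-- An inclusion of sets is an injection, as types have no literal subsets.

inclusion : (S : Signature ℓ) {Z X : Set ℓ} → Z ↣ X → Term S Z → Term S X
inclusion S {X = X} ι = eval (Fm S X) (λ z → var (Injection.to ι z))

record Hom {S : Signature ℓ} (A B : Algebra S) : Set ℓ where
  private
    module A = Algebra A
    module B = Algebra B
  field
    to   : A.Carrier → B.Carrier
    resp : ∀ {a b} → a A.≈ b → to a B.≈ to b
    homo : ∀ f as → to (A.op f as) B.≈ B.op f (map to as)

record QuasiIdentity (S : Signature ℓ) : Set ℓ where
  field
    premises   : List (Term S ℕ × Term S ℕ)
    conclusion : Term S ℕ × Term S ℕ

module _ {S : Signature ℓ} where

  Holds : (A : Algebra S) → (ℕ → Carrier A) → Term S ℕ × Term S ℕ → Set ℓ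
  Holds A ρ (s , t) = Algebra._≈_ A (eval A ρ s) (eval A ρ t)

  infix 4 _⊨_

  _⊨_ : Algebra S → QuasiIdentity S → Set ℓ
  A ⊨ q = ∀ ρ → All (Holds A ρ) premises → Holds A ρ conclusion
    where open QuasiIdentity q

  IsQuasivariety : Pred (Algebra S) κ → Set (suc ℓ ⊔ κ)
  IsQuasivariety K =
    Σ[ Q ∈ Pred (QuasiIdentity S) ℓ ] (∀ A → A ∈ K ⇔ (∀ q → q ∈ Q → A ⊨ q))

module _ {S : Signature ℓ} where

  record IsCongruence (A : Algebra S) (θ : Rel (Carrier A) ℓ) : Set ℓ where
    open Algebra A using (_≈_; op)
    field
      reflexive     : _≈_ ⇒ θ
      isEquivalence : IsEquivalence θ
      compatible    : ∀ f {as bs} → Pointwise θ as bs → θ (op f as) (op f bs)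

  infixl 7 _/_

  _/_ : (A : Algebra S) {θ : Rel (Carrier A) ℓ} → IsCongruence A θ → Algebra S
  A / θ-cong = record
    { setoid  = record { isEquivalence = IsCongruence.isEquivalence θ-cong }
    ; op      = Algebra.op A
    ; op-cong = IsCongruence.compatible θ-cong
    }

module _ {S : Signature ℓ} (K : Pred (Algebra S) κ) where

  record Co (A : Algebra S) : Set (suc ℓ ⊔ κ) where
    field
      rel          : Rel (Carrier A) ℓ
      isCongruence : IsCongruence A rel
      quotient∈K   : A / isCongruence ∈ K

  Cn : (X : Set ℓ) → Rel (Term S X) ℓ → Rel (Term S X) (suc ℓ ⊔ κ)
  Cn X Γ φ ψ =
    ∀ (A : Algebra S) → A ∈ K → (h : Hom (Fm S X) A) →
    let open Algebra A using (_≈_)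
        open Hom h using (to)
    in (∀ η ν → Γ η ν → to η ≈ to ν) → to φ ≈ to ψ

open Co public using (rel)

infix 4 _⊆ᶜ_

_⊆ᶜ_ : {S : Signature ℓ} {K : Pred (Algebra S) κ} {A : Algebra S} → Rel (Co K A) ℓ
θ ⊆ᶜ θ′ = rel θ ⇒ rel θ′

module _ {S : Signature ℓ} (K : Pred (Algebra S) κ) (δ ε : Term S ⊤) where

  i : (A : Algebra S) → Co K A → Pred (Carrier A) ℓ
  i A θ a = rel θ ((δ ^ A) a) ((ε ^ A) a)

  -- Predicates are not required to respect the equality of A: each stands for
  -- its saturation, since every i A θ respects it.

  IsLeftAdjoint : ((A : Algebra S) → Pred (Carrier A) ℓ → Co K A) → Set (suc ℓ ⊔ κ)
  IsLeftAdjoint Ξ = ∀ A → Adjoint _⊆_ _⊆ᶜ_ (Ξ A) (i A)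

  IsTheory : (X : Set ℓ) → Pred (Term S X) ℓ → Set (suc ℓ ⊔ κ)
  IsTheory X T = ∃[ θ ] T ≐ i (Fm S X) θ

-- { ⟨δ(φ),ε(φ)⟩ ∈ θ ∣ φ ∈ Fm(X) }.  For θ on Fm(X) and φ ranging over Fm(Z), use
-- this over Z with the restriction of θ along the inclusion of Fm(Z).

Instances : {S : Signature ℓ} (δ ε : Term S ⊤) (X : Set ℓ) →
            Rel (Term S X) ℓ → Rel (Term S X) ℓ
Instances {S = S} δ ε X θ η ν =
  ∃[ φ ] η ≡ (δ ^ Fm S X) φ × ν ≡ (ε ^ Fm S X) φ × θ η ν

-- Left adjoints exist for every quasivariety: Ξ A P is the K-congruence
-- generated by the pairs ⟨δ(a),ε(a)⟩ with a ∈ P.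

module Existence {S : Signature ℓ} (K : Pred (Algebra S) κ) (qv : IsQuasivariety K)
                 (δ ε : Term S ⊤) where

  private
    Q : Pred (QuasiIdentity S) ℓ
    Q = proj₁ qv

  open QuasiIdentity

  module _ (A : Algebra S) {θ : Rel (Carrier A) ℓ} (c : IsCongruence A θ) where

    eval-/ : (ρ : ℕ → Carrier A) (t : Term S ℕ) → eval (A / c) ρ t ≡ eval A ρ t
    evals-/ : ∀ (ρ : ℕ → Carrier A) {n} (ts : Vec (Term S ℕ) n) →
              evals (A / c) ρ ts ≡ evals A ρ ts
    eval-/ ρ (var v)     = refl
    eval-/ ρ (node f ts) = cong (Algebra.op A f) (evals-/ ρ ts)
    evals-/ ρ []         = refl
    evals-/ ρ (t ∷ ts)   = cong₂ _∷_ (eval-/ ρ t) (evals-/ ρ ts)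

  module _ (A : Algebra S) (P : Pred (Carrier A) ℓ) where

    open Algebra A using (_≈_; op)

    data Gen : Rel (Carrier A) ℓ where
      base   : ∀ {a} → a ∈ P → Gen ((δ ^ A) a) ((ε ^ A) a)
      eq     : ∀ {a b} → a ≈ b → Gen a b
      symm   : ∀ {a b} → Gen a b → Gen b a
      tran   : ∀ {a b c} → Gen a b → Gen b c → Gen a c
      compat : ∀ f {as bs} → Pointwise Gen as bs → Gen (op f as) (op f bs)
      quasi  : ∀ q → q ∈ Q → ∀ ρ →
               All (λ p → Gen (eval A ρ (proj₁ p)) (eval A ρ (proj₂ p))) (premises q) →
               Gen (eval A ρ (proj₁ (conclusion q))) (eval A ρ (proj₂ (conclusion q)))

    Gen-isCongruence : IsCongruence A Gen
    Gen-isCongruence = record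
      { reflexive     = eq
      ; isEquivalence = record
        { refl  = eq (IsEquivalence.refl (Algebra.isEquivalence A))
        ; sym   = symm
        ; trans = tran
        }
      ; compatible    = compat
      }

    private
      ev : ∀ ρ t → eval (A / Gen-isCongruence) ρ t ≡ eval A ρ t
      ev = eval-/ A Gen-isCongruence

      unquotient : ∀ ρ {ps} → All (Holds (A / Gen-isCongruence) ρ) ps →
                   All (λ p → Gen (eval A ρ (proj₁ p)) (eval A ρ (proj₂ p))) ps
      unquotient ρ []                     = []
      unquotient ρ (_∷_ {x = s , t} p ps) = subst₂ Gen (ev ρ s) (ev ρ t) p ∷ unquotient ρ ps

    Ξ : Co K A
    Ξ = record
      { rel          = Gen
      ; isCongruence = Gen-isCongruence
      ; quotient∈K   = Equivalence.from (proj₂ qv (A / Gen-isCongruence)) λ q q∈Q ρ ps →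
          subst₂ Gen (sym (ev ρ (proj₁ (conclusion q)))) (sym (ev ρ (proj₂ (conclusion q))))
            (quasi q q∈Q ρ (unquotient ρ ps))
      }

    module _ (θ : Co K A) (P⊆iθ : P ⊆ i K δ ε A θ) where

      private
        module θ = Co θ
        module θc = IsCongruence θ.isCongruence

      least  : Gen ⇒ rel θ
      leasts : ∀ {n} {as bs : Vec (Carrier A) n} → Pointwise Gen as bs → Pointwise (rel θ) as bs
      leastq : ∀ ρ {ps} → All (λ p → Gen (eval A ρ (proj₁ p)) (eval A ρ (proj₂ p))) ps →
               All (Holds (A / θ.isCongruence) ρ) ps

      least (base a∈P)       = P⊆iθ a∈P
      least (eq a≈b)         = θc.reflexive a≈b
      least (symm p)         = IsEquivalence.sym θc.isEquivalence (least p)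
      least (tran p q)       = IsEquivalence.trans θc.isEquivalence (least p) (least q)
      least (compat f ps)    = θc.compatible f (leasts ps)
      least (quasi q q∈Q ρ ps) =
        subst₂ (rel θ) (eval-/ A θ.isCongruence ρ (proj₁ (conclusion q)))
                       (eval-/ A θ.isCongruence ρ (proj₂ (conclusion q)))
          (Equivalence.to (proj₂ qv (A / θ.isCongruence)) θ.quotient∈K q q∈Q ρ (leastq ρ ps))

      leasts []       = []
      leasts (p ∷ ps) = least p ∷ leasts ps

      leastq ρ []                     = []
      leastq ρ (_∷_ {x = s , t} p ps) =
        subst₂ (rel θ) (sym (eval-/ A θ.isCongruence ρ s)) (sym (eval-/ A θ.isCongruence ρ t))
          (least p) ∷ leastq ρ ps

  Ξ-isLeftAdjoint : IsLeftAdjoint K δ ε Ξ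
  Ξ-isLeftAdjoint A {P} {θ} = (λ Ξ⊆θ a∈P → Ξ⊆θ (base a∈P)) , least A P θ

{-# OPTIONS --safe #-}

-- On Fm(X), both Ξ(P) and Cn({⟨δ(φ),ε(φ)⟩ ∣ φ ∈ P}) are the least K-congruence
-- identifying δ(φ) with ε(φ) for all φ ∈ P.  For P = T this rewrites the
-- left-hand side of conservativity, and for P = σ⁻¹(T) the right-hand side.

module Submission where

open import Level using (Level)
open import Data.List.Relation.Unary.All as All using ()
open import Data.Product.Base using (_×_; _,_; proj₁; proj₂)
open import Data.Unit.Base using (⊤)
open import Data.Vec.Base using (Vec; []; _∷_; map)
open import Data.Vec.Properties using (map-id)
open import Data.Vec.Relation.Binary.Pointwise.Inductive as Pointwise using (Pointwise; []; _∷_)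
open import Function.Base using (_on_; id; _∘_)
open import Function.Bundles using (_↣_; Equivalence; Injection)
open import Relation.Binary.Bundles using (Setoid)
open import Relation.Binary.Core using (Rel; _⇔_)
import Relation.Binary.Construct.On as On
open import Relation.Binary.PropositionalEquality using (_≡_; refl; cong; sym; subst₂)
open import Relation.Unary using (Pred; _∈_; _⊢_; _≐_)
open import Defs

private
  variable
    ℓ κ : Level
    S : Signature ℓ

map-eval : ∀ (A : Algebra S) {X : Set ℓ} (ρ : X → Carrier A) {n} (ts : Vec (Term S X) n) →
           map (eval A ρ) ts ≡ evals A ρ ts
map-eval A ρ []       = refl
map-eval A ρ (t ∷ ts) = cong (eval A ρ t ∷_) (map-eval A ρ ts)

evalHom : (A : Algebra S) {X : Set _} → (X → Carrier A) → Hom (Fm S X) A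
evalHom A ρ = record
  { to   = eval A ρ
  ; resp = λ { refl → A.refl }
  ; homo = λ f ts → A.reflexive (cong (Algebra.op A f) (sym (map-eval A ρ ts)))
  }
  where module A = Setoid (Algebra.setoid A)

module _ {A B : Algebra S} (h : Hom A B) where

  open Hom h
  private
    module B = Algebra B
    module ≈ = Setoid B.setoid

  module _ {X : Set κ} (ρ : X → Carrier A) where

    eval-natural  : ∀ t → to (eval A ρ t) B.≈ eval B (to ∘ ρ) t
    evals-natural : ∀ {n} (ts : Vec (Term S X) n) →
                    Pointwise B._≈_ (map to (evals A ρ ts)) (evals B (to ∘ ρ) ts)
    eval-natural (var v)     = ≈.refl
    eval-natural (node f ts) = ≈.trans (homo f (evals A ρ ts)) (B.op-cong f (evals-natural ts))
    evals-natural []         = []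
    evals-natural (t ∷ ts)   = eval-natural t ∷ evals-natural ts

    Holds-image : ∀ ((s , t) : Term S X × Term S X) →
                  to (eval A ρ s) B.≈ to (eval A ρ t) → eval B (to ∘ ρ) s B.≈ eval B (to ∘ ρ) t
    Holds-image (s , t) s≈t =
      ≈.trans (≈.sym (eval-natural s)) (≈.trans s≈t (eval-natural t))

    Holds-preimage : ∀ ((s , t) : Term S X × Term S X) →
                     eval B (to ∘ ρ) s B.≈ eval B (to ∘ ρ) t → to (eval A ρ s) B.≈ to (eval A ρ t)
    Holds-preimage (s , t) s≈t =
      ≈.trans (eval-natural s) (≈.trans s≈t (≈.sym (eval-natural t)))

  -- Quasivarieties are closed under subalgebras: premises that hold in `A` are carried to `B` along
  -- the homomorphism, `q` applies there, and injectivity is what brings the conclusion back.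
  ⊨-reflects : (∀ {a b} → to a B.≈ to b → Algebra._≈_ A a b) → ∀ q → B ⊨ q → A ⊨ q
  ⊨-reflects injective q B⊨q ρ ps = injective
    (Holds-preimage ρ conclusion
      (B⊨q (to ∘ ρ) (All.map (λ {p} → Holds-image ρ p ∘ resp) ps)))
    where open QuasiIdentity q

  ker : Rel (Carrier A) _
  ker = B._≈_ on to

  ker-isCongruence : IsCongruence A ker
  ker-isCongruence = record
    { reflexive     = resp
    ; isEquivalence = On.isEquivalence to B.isEquivalence
    ; compatible    = λ f as∼bs → ≈.trans (homo f _)
        (≈.trans (B.op-cong f (Pointwise.map⁺ id as∼bs)) (≈.sym (homo f _)))
    }

  -- The equality of the quotient is the kernel itself, so `to` is injective on it by definition.
  ker-embedding : Hom (A / ker-isCongruence) B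
  ker-embedding = record { to = to ; resp = id ; homo = homo }

quotient : ∀ {A : Algebra S} {θ} (c : IsCongruence A θ) → Hom A (A / c)
quotient {A = A} c = record
  { to   = id
  ; resp = IsCongruence.reflexive c
  ; homo = λ f as → IsCongruence.reflexive c
      (Setoid.reflexive (Algebra.setoid A) (cong (Algebra.op A f) (sym (map-id as))))
  }

-- Substituting `φ` into `δ` is itself an evaluation, in `Fm S X`, so this is naturality along the
-- homomorphism that extends `ρ`.
eval-fusion : ∀ (A : Algebra S) {X : Set _} (ρ : X → Carrier A) (δ : Term S ⊤) (φ : Term S X) →
              Algebra._≈_ A (eval A ρ ((δ ^ Fm S X) φ)) ((δ ^ A) (eval A ρ φ))
eval-fusion A ρ δ φ = eval-natural (evalHom A ρ) (λ _ → φ) δ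

module _ {S : Signature ℓ} {K : Pred (Algebra S) κ} (qv : IsQuasivariety K) where

  -- The quotient by the kernel embeds into `B`, so it inherits the quasi-identities defining `K`.
  kerCo : {A B : Algebra S} → B ∈ K → Hom A B → Co K A
  kerCo {B = B} B∈K h = record
    { rel          = ker h
    ; isCongruence = ker-isCongruence h
    ; quotient∈K   = Equivalence.from (proj₂ qv _) λ q q∈Q →
        ⊨-reflects (ker-embedding h) id q (Equivalence.to (proj₂ qv B) B∈K q q∈Q)
    }

  module _ (δ ε : Term S ⊤) {Ξ : (A : Algebra S) → Pred (Carrier A) ℓ → Co K A}
           (adjoint : IsLeftAdjoint K δ ε Ξ) where

    -- `R` is an arbitrary relation, so the restriction of a congruence along `σ` can be used
    -- without first proving that it is a `K`-congruence.
    Ξ⇔Cn : ∀ {X : Set ℓ} {P : Pred (Term S X) ℓ} {R : Rel (Term S X) ℓ} →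
           P ≐ (λ φ → R ((δ ^ Fm S X) φ) ((ε ^ Fm S X) φ)) →
           rel (Ξ (Fm S X) P) ⇔ Cn K X (Instances δ ε X R)
    Ξ⇔Cn {X} {P} {R} (P⊆R , R⊆P) = Ξ⇒Cn , Cn⇒Ξ
      where
      ΞP = Ξ (Fm S X) P

      Ξ⇒Cn : ∀ {φ ψ} → rel ΞP φ ψ → Cn K X (Instances δ ε X R) φ ψ
      -- The kernel of `h` is a `K`-congruence satisfying the equation on `P`, hence it lies above
      -- `ΞP` by adjointness.
      Ξ⇒Cn φ∼ψ A A∈K h Γ⊆ker = proj₂ (adjoint (Fm S X) {P} {kerCo A∈K h})
        (λ φ∈P → Γ⊆ker _ _ (_ , refl , refl , P⊆R φ∈P)) φ∼ψ

      Cn⇒Ξ : ∀ {φ ψ} → Cn K X (Instances δ ε X R) φ ψ → rel ΞP φ ψ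
      -- Test the consequence on the projection onto the quotient by `ΞP`, whose kernel is `ΞP`; the
      -- unit of the adjunction shows that it identifies all the instances.
      Cn⇒Ξ cn = cn (Fm S X / Co.isCongruence ΞP) (Co.quotient∈K ΞP)
        (quotient (Co.isCongruence ΞP))
        λ { _ _ (_ , refl , refl , r) → proj₁ (adjoint (Fm S X) {P} {ΞP}) id (R⊆P r) }

lemma5p10 : ∀ {ℓ κ : Level} (S : Signature ℓ) (K : Pred (Algebra S) κ) → IsQuasivariety K →
    (δ ε : Term S ⊤) →
    (∀ (Z X : Set ℓ) (ι : Z ↣ X) (θ : Co K (Fm S X)) →
    let σ = inclusion S ι in
    (Cn K X (Instances δ ε X (rel θ)) on σ) ⇔ Cn K Z (Instances δ ε Z (rel θ on σ))) →
    (Ξ : (A : Algebra S) → Pred (Carrier A) ℓ → Co K A) → IsLeftAdjoint K δ ε Ξ →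
    ∀ (Z X : Set ℓ) (ι : Z ↣ X) (T : Pred (Term S X) ℓ) → IsTheory K δ ε X T →
    let σ = inclusion S ι in
    (rel (Ξ (Fm S X) T) on σ) ⇔ rel (Ξ (Fm S Z) (σ ⊢ T))
lemma5p10 S K qv δ ε conservative Ξ adjoint Z X ι T (θ , T⊆iθ , iθ⊆T) =
    -- Conservativity is applied to the `θ` witnessing that `T` is a theory, so that its instances
    -- are exactly those indexed by `T`.
    (λ p → proj₂ onZ (proj₁ (conservative Z X ι θ) (proj₁ onX p)))
  , (λ p → proj₂ onX (proj₂ (conservative Z X ι θ) (proj₁ onZ p)))
  where
  σ = inclusion S ι

  σ-commutes : ∀ γ φ → σ ((γ ^ Fm S Z) φ) ≡ (γ ^ Fm S X) (σ φ)
  σ-commutes = eval-fusion (Fm S X) (λ z → var (Injection.to ι z))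

  onX = Ξ⇔Cn qv δ ε {Ξ} adjoint {P = T} {R = rel θ} (T⊆iθ , iθ⊆T)
  onZ = Ξ⇔Cn qv δ ε {Ξ} adjoint {P = σ ⊢ T} {R = rel θ on σ}
    -- Membership of `σ φ` in `T` concerns `δ` at `σ φ`, while the restricted relation concerns `σ`
    -- of `δ` at `φ`; `σ-commutes` passes between the two.
    ( (λ {φ} σφ∈T → subst₂ (rel θ) (sym (σ-commutes δ φ)) (sym (σ-commutes ε φ)) (T⊆iθ σφ∈T))
    , (λ {φ} r → iθ⊆T (subst₂ (rel θ) (σ-commutes δ φ) (σ-commutes ε φ) r)) )
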